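{- Let $\mathcal G=(V,\to,\Omega,\mathcal P)$ be a parity game and let $\mathcal G_q=(V_{/\approx},\to',\Omega',\mathcal P')$ be its governed bisimulation quotient, where $\approx$ denotes governed bisimilarity. Then $\mathcal G\approx\mathcal G_q$.
   Context: A parity game is a tuple $(V,\to,\Omega,\mathcal P)$ where $V$ is a finite set of vertices, $\to\subseteq V\times V$ is total (every vertex has at least one successor), $\Omega:V\to\mathbb N$ is a priority function, and $\mathcal P:V\to\{\Diamond,\Box\}$ assigns each vertex to player even ($\Diamond$) or odd ($\Box$). Write $V_\Diamond,V_\Box$ for the vertices owned by each player and $v^\bullet=\{w\mid v\to w\}$. A symmetric relation $R\subseteq V\times V$ is a governed bisimulation iff $v\,R\,w$ implies: (1) $\Omega(v)=\Omega(w)$; (2) if $\mathcal P(v)\neq\mathcal P(w)$, then $v'\,R\,w'$ for all $v'\in v^\bullet$ and $w'\in w^\bullet$; (3) for all $v'\in v^\bullet$ there is some $w'\in w^\bullet$ with $v'\,R\,w'$. Governed bisimilarity: $v\approx w$ iff some governed bisimulation $R$ has $v\,R\,w$ (this is an equivalence relation). $V_{/\approx}$ is the set of its classes and $[V']_\approx=\{[v]_\approx\mid v\in V'\}$ for $V'\subseteq V$. Governed bisimulation quotient of $(V,\to,\Omega,\mathcal P)$: the structure $(V_{/\approx},\to',\Omega',\mathcal P')$ with, for classes $\mathcal C,\mathcal C'$: - $\Omega'(\mathcal C)=\min\{\Omega(v)\mid v\in\mathcal C\}$; - $\mathcal P'(\mathcal C)=\Box$ if $\mathcal C\subseteq V_\Box$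 and $|[u^\bullet]_\approx|>1$ for all $u\in\mathcal C$; $\mathcal P'(\mathcal C)=\Diamond$ otherwise; - $\mathcal C\to'\mathcal C'$ iff for all $v\in\mathcal C$ there is $v'\in v^\bullet$ with $v'\in\mathcal C'$. Equivalence of games: for parity games $\mathcal G_1,\mathcal G_2$ with vertex sets $V_1,V_2$ and a vertex equivalence $\sim$, $\mathcal G_1\sim\mathcal G_2$ iff in the disjoint union of $\mathcal G_1$ and $\mathcal G_2$, every $v_1\in V_1$ has some $v_2\in V_2$ with $v_1\sim v_2$, and every $v_2\in V_2$ has some $v_1\in V_1$ with $v_1\sim v_2$. -}

module Defs where

open import Level using (Level; 0ℓ) renaming (suc to lsuc)
open import Data.Bool using (if_then_else_)
open import Data.Bool.Properties using () renaming (_≟_ to _≟ᵇ_)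
open import Data.Empty using (⊥-elim)
open import Data.Fin using (Fin; zero; suc; combine; remQuot)
import Data.Fin.Properties as Fin
open import Data.Fin.Subset using (Subset) renaming (_∈_ to _∈ˢ_)
open import Data.Fin.Subset.Properties using (anySubset?) renaming (_∈?_ to _∈ˢ?_)
open import Data.List using (List; map; filter; deduplicate; length; lookup; allFin)
open import Data.List.Extrema.Nat using (min)
open import Data.List.Membership.Propositional using (_∈_)
open import Data.List.Membership.Propositional.Properties
  using (∈-map⁺; ∈-allFin; ∈-deduplicate⁺)
import Data.List.Relation.Unary.All as All
open import Data.List.Relation.Unary.Any using (here; there; index)
open import Data.List.Relation.Unary.Any.Properties using (lookup-index)
open import Data.List.Relation.Unary.AllPairs using (_∷_)
open import Data.List.Relation.Unary.Unique.Propositional using (Unique)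
import Data.List.Relation.Unary.Unique.DecPropositional.Properties as Unique
open import Data.Nat using (ℕ; zero; suc; _+_; _*_; _>_; _>?_)
import Data.Nat.Properties as ℕ
open import Data.Product using (Σ; ∃; ∃-syntax; _×_; _,_; proj₁; proj₂)
open import Data.Sum using (_⊎_; inj₁; inj₂; [_,_])
open import Data.Sum.Function.Propositional using (_⊎-↔_)
open import Data.Sum.Relation.Binary.Pointwise
  using (Pointwise; inj₁; inj₂; ⊎-decidable)
open import Data.Vec using (tabulate)
open import Data.Vec.Properties
  using (lookup∘tabulate; lookup⇒[]=; []=⇒lookup; ≡-dec)
open import Function using (_∘_)
open import Function.Bundles using (_↔_; mk↔ₛ′; module Inverse)
open import Function.Construct.Composition using (_↔-∘_)
open import Function.Construct.Symmetry using (↔-sym)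
open import Relation.Binary
  using (Rel; Symmetric; Decidable; DecidableEquality)
open import Relation.Binary.PropositionalEquality
  using (_≡_; _≢_; refl; sym; trans; cong; cong₂; subst)
open import Relation.Nullary using (Dec; yes; no; does; ¬_; contradiction)
open import Relation.Nullary.Decidable
  using (map′; _×-dec_; _→-dec_; ¬?; recompute; dec-true; decidable-stable
        ; ¬¬-excluded-middle)
open import Relation.Unary using (Pred) renaming (Decidable to Decidable₁)

private
  variable
    ℓ : Level
    n : ℕ

module FiniteType {A : Set} (A↔Fin : A ↔ Fin n) where

  open Inverse A↔Fin using (to; from; strictlyInverseʳ)

  elements : List A
  elements = map from (allFin n)

  all? : {P : Pred A ℓ} → Decidable₁ P → Dec (∀ x → P x)
  all? {P = P} P? = map′
    (λ f x → subst P (strictlyInverseʳ x) (f (to x)))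
    (λ f i → f (from i))
    (Fin.all? (P? ∘ from))

  any? : {P : Pred A ℓ} → Decidable₁ P → Dec (∃[ x ] P x)
  any? {P = P} P? = map′
    (λ (i , p) → from i , p)
    (λ (x , p) → to x , subst P (sym (strictlyInverseʳ x)) p)
    (Fin.any? (P? ∘ from))

  _≟_ : DecidableEquality A
  x ≟ y = map′
    (λ eq → trans (sym (strictlyInverseʳ x)) (trans (cong from eq) (strictlyInverseʳ y)))
    (cong to)
    (to x Fin.≟ to y)

  -- A surjective image of a finite type with decidable equality is finite.
  module Image {B : Set} (_≟ᴮ_ : DecidableEquality B)
               (f : A → B) (f-surj : ∀ b → ∃[ a ] b ≡ f a) where

    values : List B
    values = deduplicate _≟ᴮ_ (map f elements)

    private
      covers : ∀ b → b ∈ values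
      covers b with f-surj b
      ... | a , refl = ∈-deduplicate⁺ _≟ᴮ_ (∈-map⁺ f
        (subst (_∈ elements) (strictlyInverseʳ a) (∈-map⁺ from (∈-allFin (to a)))))

      lookup-injective : ∀ {xs : List B} → Unique xs →
        ∀ i j → lookup xs i ≡ lookup xs j → i ≡ j
      lookup-injective (_ ∷ _)   zero    zero    _  = refl
      lookup-injective {_ List.∷ xs} (x∉ ∷ _) zero (suc j) eq =
        ⊥-elim (All.lookupAny x∉ (at xs j) .proj₁ (trans eq (All.lookupAny x∉ (at xs j) .proj₂)))
        where
        at : ∀ xs (j : Fin (length xs)) → lookup xs j ∈ xs
        at (_ List.∷ _)  zero    = here refl
        at (_ List.∷ xs) (suc j) = there (at xs j)
      lookup-injective u@(_ ∷ _) (suc i) zero    eq = sym (lookup-injective u zero (suc i) (sym eq))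
      lookup-injective (_ ∷ u)   (suc i) (suc j) eq = cong suc (lookup-injective u i j eq)

    image-finite : B ↔ Fin (length values)
    image-finite = mk↔ₛ′ (index ∘ covers) (lookup values)
      (λ i → lookup-injective (Unique.deduplicate-! _≟ᴮ_ (map f elements)) _ _
               (sym (lookup-index (covers (lookup values i)))))
      (λ b → sym (lookup-index (covers b)))

data Player : Set where
  ◇ □ : Player

_≟ᴾ_ : DecidableEquality Player
◇ ≟ᴾ ◇ = yes refl
◇ ≟ᴾ □ = no λ ()
□ ≟ᴾ ◇ = no λ ()
□ ≟ᴾ □ = yes refl

-- The finite data (vertices and edges) are given decidably: `size` and
-- `finite` exhibit V as a finite set and `_⟶?_` makes ⟶ a subset of V × V.
record ParityGame : Set₁ where
  infix 4 _⟶_ _⟶?_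
  field
    V      : Set
    size   : ℕ
    finite : V ↔ Fin size
    _⟶_    : Rel V 0ℓ
    _⟶?_   : Decidable _⟶_
    total  : ∀ v → ∃[ w ] v ⟶ w
    Ω      : V → ℕ
    𝒫      : V → Player

infixr 5 _⊎ᴳ_
_⊎ᴳ_ : ParityGame → ParityGame → ParityGame
𝒢₁ ⊎ᴳ 𝒢₂ = record
  { V      = G₁.V ⊎ G₂.V
  ; size   = G₁.size + G₂.size
  ; finite = (↔-sym Fin.+↔⊎) ↔-∘ (G₁.finite ⊎-↔ G₂.finite)
  ; _⟶_    = Pointwise G₁._⟶_ G₂._⟶_
  ; _⟶?_   = ⊎-decidable G₁._⟶?_ G₂._⟶?_
  ; total  = λ where
      (inj₁ v) → let w , v⟶w = G₁.total v in inj₁ w , inj₁ v⟶w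
      (inj₂ v) → let w , v⟶w = G₂.total v in inj₂ w , inj₂ v⟶w
  ; Ω      = [ G₁.Ω , G₂.Ω ]
  ; 𝒫      = [ G₁.𝒫 , G₂.𝒫 ]
  }
  where
  module G₁ = ParityGame 𝒢₁
  module G₂ = ParityGame 𝒢₂

EquivalentVia : (∀ 𝒢 → Rel (ParityGame.V 𝒢) ℓ) → Rel ParityGame ℓ
EquivalentVia ∼ 𝒢₁ 𝒢₂ =
    (∀ v₁ → ∃[ v₂ ] ∼ (𝒢₁ ⊎ᴳ 𝒢₂) (inj₁ v₁) (inj₂ v₂))
  × (∀ v₂ → ∃[ v₁ ] ∼ (𝒢₁ ⊎ᴳ 𝒢₂) (inj₁ v₁) (inj₂ v₂))

module Governed (𝒢 : ParityGame) where

  open ParityGame 𝒢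
  open FiniteType finite using (all?; any?)
  open Inverse finite using (to; from; strictlyInverseʳ)

  record IsGovernedBisimulation (R : Rel V 0ℓ) : Set where
    field
      symmetric : Symmetric R
      priority  : ∀ {v w} → R v w → Ω v ≡ Ω w
      owner     : ∀ {v w} → R v w → 𝒫 v ≢ 𝒫 w →
                  ∀ {v′ w′} → v ⟶ v′ → w ⟶ w′ → R v′ w′
      transfer  : ∀ {v w} → R v w →
                  ∀ {v′} → v ⟶ v′ → ∃[ w′ ] (w ⟶ w′ × R v′ w′)

  infix 4 _≈_ _≈?_

  _≈_ : Rel V (lsuc 0ℓ)
  v ≈ w = Σ (Rel V 0ℓ) λ R → IsGovernedBisimulation R × R v w

  open IsGovernedBisimulation

  ≈-refl : ∀ {v} → v ≈ v
  ≈-refl = _≡_ , record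
    { symmetric = sym
    ; priority  = cong Ω
    ; owner     = λ { refl 𝒫≢ → contradiction refl 𝒫≢ }
    ; transfer  = λ { refl v⟶v′ → _ , v⟶v′ , refl }
    } , refl

  ≈-transfer : ∀ {v w v′} → v ≈ w → v ⟶ v′ → ∃[ w′ ] (w ⟶ w′ × v′ ≈ w′)
  ≈-transfer (R , R-bisim , vRw) v⟶v′ =
    let w′ , w⟶w′ , v′Rw′ = transfer R-bisim vRw v⟶v′
    in  w′ , w⟶w′ , R , R-bisim , v′Rw′

  -- Deciding ≈: it suffices to search the decidable relations, coded as
  -- subsets of Fin (size * size), since on a finite set every relation is
  -- not not decidable.

  private
    Code : Set
    Code = Subset (size * size)

    ⟦_⟧ : Code → Rel V 0ℓ
    ⟦ S ⟧ v w = combine (to v) (to w) ∈ˢ S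

    isGovernedBisimulation? : {R : Rel V 0ℓ} → Decidable R → Dec (IsGovernedBisimulation R)
    isGovernedBisimulation? R? = map′
      (λ (s , p , o , t) → record
        { symmetric = s _ _
        ; priority  = p _ _
        ; owner     = λ r 𝒫≢ e f → o _ _ r 𝒫≢ _ _ e f
        ; transfer  = λ r e → t _ _ r _ e
        })
      (λ b → (λ _ _ → symmetric b) , (λ _ _ → priority b)
           , (λ _ _ r 𝒫≢ _ _ e f → owner b r 𝒫≢ e f)
           , (λ _ _ r _ e → transfer b r e))
      ( (all? λ v → all? λ w → R? v w →-dec R? w v)
      ×-dec (all? λ v → all? λ w → R? v w →-dec (Ω v ℕ.≟ Ω w))
      ×-dec (all? λ v → all? λ w → R? v w →-dec (¬? (𝒫 v ≟ᴾ 𝒫 w) →-dec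
              (all? λ v′ → all? λ w′ → (v ⟶? v′) →-dec ((w ⟶? w′) →-dec R? v′ w′))))
      ×-dec (all? λ v → all? λ w → R? v w →-dec
              (all? λ v′ → (v ⟶? v′) →-dec (any? λ w′ → (w ⟶? w′) ×-dec R? v′ w′))))

    ⟦_⟧? : ∀ S → Decidable ⟦ S ⟧
    ⟦ S ⟧? v w = combine (to v) (to w) ∈ˢ? S

    transport : {R R′ : Rel V 0ℓ} → (∀ {v w} → R v w → R′ v w) → (∀ {v w} → R′ v w → R v w) →
                IsGovernedBisimulation R → IsGovernedBisimulation R′
    transport f g b = record
      { symmetric = f ∘ symmetric b ∘ g
      ; priority  = priority b ∘ g
      ; owner     = λ r 𝒫≢ e e′ → f (owner b (g r) 𝒫≢ e e′)
      ; transfer  = λ r e → let w′ , e′ , r′ = transfer b (g r) e in w′ , e′ , f r′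
      }

    ∈-tabulate⁺ : ∀ {m} {P : Pred (Fin m) ℓ} (P? : Decidable₁ P) {i} →
                  P i → i ∈ˢ tabulate (does ∘ P?)
    ∈-tabulate⁺ P? {i} p =
      lookup⇒[]= i _ (trans (lookup∘tabulate (does ∘ P?) i) (dec-true (P? i) p))

    ∈-tabulate⁻ : ∀ {m} {P : Pred (Fin m) ℓ} (P? : Decidable₁ P) {i} →
                  i ∈ˢ tabulate (does ∘ P?) → P i
    ∈-tabulate⁻ P? {i} i∈ with P? i | trans (sym (lookup∘tabulate (does ∘ P?) i)) ([]=⇒lookup i∈)
    ... | yes p | _ = p

    ¬¬-decidable : ∀ {m} (P : Pred (Fin m) 0ℓ) → ¬ ¬ Decidable₁ P
    ¬¬-decidable {zero}  P k = k λ ()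
    ¬¬-decidable {suc m} P k = ¬¬-excluded-middle λ P₀? →
      ¬¬-decidable (P ∘ suc) λ P₊? → k λ { zero → P₀? ; (suc i) → P₊? i }

    encode : (R : Rel V 0ℓ) → ¬ ¬ (∃[ S ] ((∀ {v w} → R v w → ⟦ S ⟧ v w) × (∀ {v w} → ⟦ S ⟧ v w → R v w)))
    encode R k = ¬¬-decidable P λ P? → k
      ( tabulate (does ∘ P?)
      , (λ r → ∈-tabulate⁺ P? (subst (λ (a , b) → R a b) (sym (decode _ _)) r))
      , (λ r → subst (λ (a , b) → R a b) (decode _ _) (∈-tabulate⁻ P? r)))
      where
      pair : Fin (size * size) → V × V
      pair i = from (proj₁ (remQuot {size} size i)) , from (proj₂ (remQuot {size} size i))

      P : Pred (Fin (size * size)) 0ℓ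
      P i = R (proj₁ (pair i)) (proj₂ (pair i))

      decode : ∀ v w → pair (combine (to v) (to w)) ≡ (v , w)
      decode v w = trans
        (cong (λ (i , j) → from i , from j) (Fin.remQuot-combine (to v) (to w)))
        (cong₂ _,_ (strictlyInverseʳ v) (strictlyInverseʳ w))

  _≈?_ : Decidable _≈_
  v ≈? w = map′ (λ (S , b , r) → ⟦ S ⟧ , b , r) complete search
    where
    search : Dec (∃[ S ] (IsGovernedBisimulation ⟦ S ⟧ × ⟦ S ⟧ v w))
    search = anySubset? λ S → isGovernedBisimulation? ⟦ S ⟧? ×-dec ⟦ S ⟧? v w

    complete : v ≈ w → ∃[ S ] (IsGovernedBisimulation ⟦ S ⟧ × ⟦ S ⟧ v w)
    complete (R , b , r) = decidable-stable search λ k →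
      encode R λ (S , f , g) → k (S , transport f g b , f r)

  classMembers : V → Subset size
  classMembers v = tabulate λ i → does (v ≈? from i)

  -- The proof that a class has the form [v] is irrelevant,
  -- so that classes are equal exactly when they have the same members.
  record Class : Set where
    constructor mkClass
    field
      members  : Subset size
      .isClass : ∃[ v ] members ≡ classMembers v

  open Class

  V/≈ : Set
  V/≈ = Class

  infix 4 _∈ᶜ_ _∈ᶜ?_ _⟶′_ _⟶′?_

  _∈ᶜ_ : V → Class → Set
  v ∈ᶜ C = to v ∈ˢ members C

  _∈ᶜ?_ : Decidable _∈ᶜ_
  v ∈ᶜ? C = to v ∈ˢ? members C

  [_]≈ : V → Class
  [ v ]≈ = mkClass (classMembers v) (v , refl)

  _≟ᶜ_ : DecidableEquality Class
  mkClass C _ ≟ᶜ mkClass D _ = map′ (λ { refl → refl }) (cong members) (≡-dec _≟ᵇ_ C D)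

  ∈-class⁺ : ∀ {v w} → v ≈ w → w ∈ᶜ [ v ]≈
  ∈-class⁺ {v} {w} v≈w =
    ∈-tabulate⁺ (λ i → v ≈? from i) (subst (v ≈_) (sym (strictlyInverseʳ w)) v≈w)

  ∈-class⁻ : ∀ {v w} → w ∈ᶜ [ v ]≈ → v ≈ w
  ∈-class⁻ {v} {w} w∈ =
    subst (v ≈_) (strictlyInverseʳ w) (∈-tabulate⁻ (λ i → v ≈? from i) w∈)

  representative : ∀ C → ∃[ v ] C ≡ [ v ]≈
  representative (mkClass C isClass)
    with v , refl ← recompute (any? λ v → ≡-dec _≟ᵇ_ C (classMembers v)) isClass
    = v , refl

  Class-finite : Class ↔ Fin _
  Class-finite = FiniteType.Image.image-finite finite _≟ᶜ_ [_]≈ representative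

  -- [v•]≈ , listed without repetition
  successorClasses : V → List Class
  successorClasses v =
    deduplicate _≟ᶜ_ (map [_]≈ (filter (v ⟶?_) (FiniteType.elements finite)))

  -- The first argument of `min` is the default for empty lists; being the
  -- priority of a member of C, it does not affect the minimum.
  Ω′ : Class → ℕ
  Ω′ C = min (Ω (proj₁ (representative C)))
             (map Ω (filter (_∈ᶜ? C) (FiniteType.elements finite)))

  OwnedByOdd : Class → Set
  OwnedByOdd C = (∀ u → u ∈ᶜ C → 𝒫 u ≡ □)
               × (∀ u → u ∈ᶜ C → length (successorClasses u) > 1)

  ownedByOdd? : Decidable₁ OwnedByOdd
  ownedByOdd? C =
          (all? λ u → (u ∈ᶜ? C) →-dec (𝒫 u ≟ᴾ □))
    ×-dec (all? λ u → (u ∈ᶜ? C) →-dec (length (successorClasses u) >? 1))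

  𝒫′ : Class → Player
  𝒫′ C = if does (ownedByOdd? C) then □ else ◇

  _⟶′_ : Rel Class 0ℓ
  C ⟶′ C′ = ∀ v → v ∈ᶜ C → ∃[ v′ ] (v ⟶ v′ × v′ ∈ᶜ C′)

  _⟶′?_ : Decidable _⟶′_
  C ⟶′? C′ = all? λ v → (v ∈ᶜ? C) →-dec (any? λ v′ → (v ⟶? v′) ×-dec (v′ ∈ᶜ? C′))

  total′ : ∀ C → ∃[ C′ ] C ⟶′ C′
  total′ C with representative C
  ... | v , refl with total v
  ...   | w , v⟶w = [ w ]≈ , λ u u∈[v] →
    let u′ , u⟶u′ , w≈u′ = ≈-transfer (∈-class⁻ u∈[v]) v⟶w
    in  u′ , u⟶u′ , ∈-class⁺ w≈u′

  quotient : ParityGame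
  quotient = record
    { V      = V/≈
    ; size   = _
    ; finite = Class-finite
    ; _⟶_    = _⟶′_
    ; _⟶?_   = _⟶′?_
    ; total  = total′
    ; Ω      = Ω′
    ; 𝒫      = 𝒫′
    }

open Governed public using (IsGovernedBisimulation; quotient)

infix 4 _≈ᴳ_
_≈ᴳ_ : Rel ParityGame (lsuc 0ℓ)
_≈ᴳ_ = EquivalentVia Governed._≈_

{-# OPTIONS --safe #-}
-- Membership between vertices and classes is a governed bisimulation on the
-- disjoint union.  The delicate point is the owner condition: if v ∈ C,
-- 𝒫 v = □ and 𝒫′ C = ◇, but some successor v′ of v lies outside some successor
-- C′ of C, then no u ∈ C belongs to ◇ (otherwise the owner condition for v ≈ u
-- would identify all successors of v) and every u ∈ C has a successor equivalent
-- to v′ and one in C′, hence two successor classes.  So C would be owned by □.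
module Submission where

open import Defs
open import Level using (0ℓ)
open import Data.Bool using (if_then_else_)
open import Data.Fin using (Fin)
open import Data.List using (List; length)
open import Data.List.Extrema.Nat using (argmin-all)
open import Data.List.Membership.Propositional using (_∈_)
open import Data.List.Membership.Propositional.Properties
  using (∈-map⁺; ∈-allFin; ∈-deduplicate⁺; ∈-filter⁺)
import Data.List.Relation.Unary.All as All
open import Data.List.Relation.Unary.All.Properties using (all-filter; map⁺)
open import Data.List.Relation.Unary.Any using (here; there)
open import Data.Nat using (ℕ; _>_; z≤n; s≤s)
open import Data.Product using (∃-syntax; _×_; _,_; proj₁; proj₂)
open import Data.Sum using (_⊎_; inj₁; inj₂; [_,_])
open import Data.Sum.Relation.Binary.Pointwise using (inj₁; inj₂)
open import Function using (_∘_; id)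
open import Function.Bundles using (_↔_; module Inverse)
open import Relation.Binary using (Rel)
open import Relation.Binary.PropositionalEquality
  using (_≡_; _≢_; refl; sym; trans; subst)
open import Relation.Nullary using (Dec; yes; no; does; ¬_; contradiction)
open import Relation.Nullary.Decidable using (True; toWitness; fromWitness; decidable-stable)

distinct-members⇒length>1 : {A : Set} {x y : A} {xs : List A} →
  x ∈ xs → y ∈ xs → x ≢ y → length xs > 1
distinct-members⇒length>1 (here refl)         (here refl)         x≢y = contradiction refl x≢y
distinct-members⇒length>1 (here _)            (there (here _))    _   = s≤s (s≤s z≤n)
distinct-members⇒length>1 (here _)            (there (there _))   _   = s≤s (s≤s z≤n)
distinct-members⇒length>1 (there (here _))    _                   _   = s≤s (s≤s z≤n)
distinct-members⇒length>1 (there (there _))   _                   _   = s≤s (s≤s z≤n)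

∈-elements : {A : Set} {n : ℕ} (A↔Fin : A ↔ Fin n) (a : A) → a ∈ FiniteType.elements A↔Fin
∈-elements A↔Fin a =
  subst (_∈ FiniteType.elements A↔Fin) (strictlyInverseʳ a) (∈-map⁺ from (∈-allFin (to a)))
  where open Inverse A↔Fin using (to; from; strictlyInverseʳ)

-- Keeping `A?` a variable lets a plain match reduce `does A?`; the compound decision
-- `ownedByOdd? C` is then handled by instantiation.
if-cases : {A B : Set} {x y : B} (A? : Dec A) →
  (A × (if does A? then x else y) ≡ x) ⊎ (¬ A × (if does A? then x else y) ≡ y)
if-cases (yes a) = inj₁ (a , refl)
if-cases (no ¬a) = inj₂ (¬a , refl)

module GovernedProperties (𝒢 : ParityGame) where

  open ParityGame 𝒢
  open Governed 𝒢 hiding (IsGovernedBisimulation; quotient)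
  open IsGovernedBisimulation

  ≈-sym : ∀ {v w} → v ≈ w → w ≈ v
  ≈-sym (R , b , r) = R , b , symmetric b r

  ≈-priority : ∀ {v w} → v ≈ w → Ω v ≡ Ω w
  ≈-priority (_ , b , r) = priority b r

  ≈-owner : ∀ {v w v′ w′} → v ≈ w → 𝒫 v ≢ 𝒫 w → v ⟶ v′ → w ⟶ w′ → v′ ≈ w′
  ≈-owner (R , b , r) 𝒫≢ e f = R , b , owner b r 𝒫≢ e f

  -- v ≈ w itself lives in Set₁, hence is not a candidate relation; its
  -- decision procedure provides a copy of ≈ in Set.
  _≈≈_ : Rel V 0ℓ
  v ≈≈ w = ∃[ u ] (True (v ≈? u) × True (u ≈? w))

  ≈≈-isGovernedBisimulation : IsGovernedBisimulation 𝒢 _≈≈_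
  ≈≈-isGovernedBisimulation = record
    { symmetric = λ (u , p , q) → compose (≈-sym (toWitness q)) (≈-sym (toWitness p))
    ; priority  = λ (u , p , q) → trans (≈-priority (toWitness p)) (≈-priority (toWitness q))
    ; owner     = λ (u , p , q) 𝒫≢ e g → ≈≈-owner (toWitness p) (toWitness q) 𝒫≢ e g
    ; transfer  = λ (u , p , q) e →
        let u′ , f , v′≈u′ = ≈-transfer (toWitness p) e
            w′ , g , u′≈w′ = ≈-transfer (toWitness q) f
        in  w′ , g , compose v′≈u′ u′≈w′
    }
    where
    compose : ∀ {v u w} → v ≈ u → u ≈ w → v ≈≈ w
    compose p q = _ , fromWitness p , fromWitness q

    -- The middle vertex `u` differs in owner from `v` or from `w`. On that side all successors are
    -- related, so the successor of `u` that transfer supplies on the other side links `v′` to `w′`.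
    ≈≈-owner : ∀ {v u w v′ w′} → v ≈ u → u ≈ w → 𝒫 v ≢ 𝒫 w → v ⟶ v′ → w ⟶ w′ → v′ ≈≈ w′
    ≈≈-owner {v} {u} v≈u u≈w 𝒫≢ e g = by-owner (𝒫 v ≟ᴾ 𝒫 u)
      where
      by-owner : Dec (𝒫 v ≡ 𝒫 u) → _ ≈≈ _
      by-owner (no 𝒫v≢𝒫u) =
        let u′ , f , w′≈u′ = ≈-transfer (≈-sym u≈w) g
        in  compose (≈-owner v≈u 𝒫v≢𝒫u e f) (≈-sym w′≈u′)
      by-owner (yes 𝒫v≡𝒫u) =
        let u′ , f , v′≈u′ = ≈-transfer v≈u e
        in  compose v′≈u′ (≈-owner u≈w (𝒫≢ ∘ trans 𝒫v≡𝒫u) f g)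

  ≈-trans : ∀ {u v w} → u ≈ v → v ≈ w → u ≈ w
  ≈-trans p q = _≈≈_ , ≈≈-isGovernedBisimulation , _ , fromWitness p , fromWitness q

  representative-∈ᶜ : ∀ C → proj₁ (representative C) ∈ᶜ C
  representative-∈ᶜ C = subst (v ∈ᶜ_) (sym C≡[v]) (∈-class⁺ ≈-refl)
    where
    v = proj₁ (representative C)
    C≡[v] = proj₂ (representative C)

  representative-≈ : ∀ {v} C → v ∈ᶜ C → proj₁ (representative C) ≈ v
  representative-≈ {v} C v∈C = ∈-class⁻ (subst (v ∈ᶜ_) (proj₂ (representative C)) v∈C)

  -- Both members are equivalent to the chosen representative, so transitivity of `≈` joins them.
  ∈ᶜ-related : ∀ {v w} C → v ∈ᶜ C → w ∈ᶜ C → v ≈ w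
  ∈ᶜ-related C v∈C w∈C = ≈-trans (≈-sym (representative-≈ C v∈C)) (representative-≈ C w∈C)

  ∈ᶜ-resp-≈ : ∀ {v w} C → v ≈ w → v ∈ᶜ C → w ∈ᶜ C
  ∈ᶜ-resp-≈ {w = w} C v≈w v∈C = subst (w ∈ᶜ_) (sym (proj₂ (representative C)))
    (∈-class⁺ (≈-trans (representative-≈ C v∈C) v≈w))

  -- `Ω` is constant on a class, so the default of `min` and every listed value equal `Ω v`;
  -- `argmin-all` passes this on to the minimum.
  Ω≡Ω′ : ∀ {v} C → v ∈ᶜ C → Ω v ≡ Ω′ C
  Ω≡Ω′ {v} C v∈C = argmin-all id {P = Ω v ≡_} (Ωv≡ (representative-∈ᶜ C))
    (map⁺ (All.map Ωv≡ (all-filter (_∈ᶜ? C) (FiniteType.elements finite))))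
    where
    Ωv≡ : ∀ {w} → w ∈ᶜ C → Ω v ≡ Ω w
    Ωv≡ w∈C = ≈-priority (∈ᶜ-related C v∈C w∈C)

  ∈-successorClasses : ∀ {v w} → v ⟶ w → [ w ]≈ ∈ successorClasses v
  ∈-successorClasses {v} {w} v⟶w =
    ∈-deduplicate⁺ _≟ᶜ_ (∈-map⁺ [_]≈ (∈-filter⁺ (v ⟶?_) (∈-elements finite w) v⟶w))

  ⟶⇒⟶′ : ∀ {v w} C → v ∈ᶜ C → v ⟶ w → C ⟶′ [ w ]≈
  ⟶⇒⟶′ C v∈C v⟶w u u∈C =
    let u′ , u⟶u′ , w≈u′ = ≈-transfer (∈ᶜ-related C v∈C u∈C) v⟶w
    in  u′ , u⟶u′ , ∈-class⁺ w≈u′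

  𝒫′-cases : ∀ C → (OwnedByOdd C × 𝒫′ C ≡ □) ⊎ (¬ OwnedByOdd C × 𝒫′ C ≡ ◇)
  𝒫′-cases C = if-cases (ownedByOdd? C)

  ∈ᶜ-owner : ∀ {v v′} C C′ → v ∈ᶜ C → 𝒫 v ≢ 𝒫′ C → v ⟶ v′ → C ⟶′ C′ → v′ ∈ᶜ C′
  ∈ᶜ-owner {v} {v′} C C′ v∈C 𝒫≢ v⟶v′ C⟶C′ =
    -- If `□` owns `C`, it owns the member `v` too, against `𝒫≢`.
    [ (λ ((allOdd , _) , 𝒫′C≡□) → contradiction (trans (allOdd v v∈C) (sym 𝒫′C≡□)) 𝒫≢)
    -- Membership in `C′` is decidable, so refuting `v′∉C′` suffices.
    , (λ (¬odd , 𝒫′C≡◇) → decidable-stable (v′ ∈ᶜ? C′) λ v′∉C′ →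
        ¬odd (allOdd v′∉C′ 𝒫′C≡◇ , branching v′∉C′))
    ] (𝒫′-cases C)
    where
    ≢□⇒≡◇ : ∀ {p} → p ≢ □ → p ≡ ◇
    ≢□⇒≡◇ {◇} _   = refl
    ≢□⇒≡◇ {□} p≢□ = contradiction refl p≢□

    allOdd : ¬ v′ ∈ᶜ C′ → 𝒫′ C ≡ ◇ → ∀ u → u ∈ᶜ C → 𝒫 u ≡ □
    allOdd v′∉C′ 𝒫′C≡◇ u u∈C = decidable-stable (𝒫 u ≟ᴾ □) λ 𝒫u≢□ →
      let u′ , u⟶u′ , u′∈C′ = C⟶C′ u u∈C
          -- Here `𝒫 u` and `𝒫′ C` are both `◇`, while `𝒫 v` differs from `𝒫′ C`.
          𝒫v≢𝒫u = λ eq → 𝒫≢ (trans eq (trans (≢□⇒≡◇ 𝒫u≢□) (sym 𝒫′C≡◇)))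
          v′≈u′ = ≈-owner (∈ᶜ-related C v∈C u∈C) 𝒫v≢𝒫u v⟶v′ u⟶u′
      in  v′∉C′ (∈ᶜ-resp-≈ C′ (≈-sym v′≈u′) u′∈C′)

    branching : ¬ v′ ∈ᶜ C′ → ∀ u → u ∈ᶜ C → length (successorClasses u) > 1
    branching v′∉C′ u u∈C =
      let u′ , u⟶u′ , v′≈u′ = ≈-transfer (∈ᶜ-related C v∈C u∈C) v⟶v′
          u″ , u⟶u″ , u″∈C′ = C⟶C′ u u∈C
      in  distinct-members⇒length>1 (∈-successorClasses u⟶u′) (∈-successorClasses u⟶u″)
            λ [u′]≡[u″] →
              -- Equal classes would give `u″ ≈ u′ ≈ v′`, pulling `v′` into `C′`.
              let u″≈u′ = ∈-class⁻ (subst (u′ ∈ᶜ_) [u′]≡[u″] (∈-class⁺ ≈-refl))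
              in  v′∉C′ (∈ᶜ-resp-≈ C′ (≈-trans u″≈u′ (≈-sym v′≈u′)) u″∈C′)

  -- Only pairs across the two summands are related; the second constructor makes the relation
  -- symmetric.
  data Membership : Rel (V ⊎ V/≈) 0ℓ where
    vertex∈class : ∀ {v C} → v ∈ᶜ C → Membership (inj₁ v) (inj₂ C)
    class∋vertex : ∀ {v C} → v ∈ᶜ C → Membership (inj₂ C) (inj₁ v)

  membership-isGovernedBisimulation :
    IsGovernedBisimulation (𝒢 ⊎ᴳ quotient 𝒢) Membership
  membership-isGovernedBisimulation = record
    { symmetric = λ { (vertex∈class v∈C) → class∋vertex v∈C
                    ; (class∋vertex v∈C) → vertex∈class v∈C }
    ; priority  = λ { (vertex∈class {C = C} v∈C) → Ω≡Ω′ C v∈C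
                    ; (class∋vertex {C = C} v∈C) → sym (Ω≡Ω′ C v∈C) }
    ; owner     = λ { (vertex∈class {C = C} v∈C) 𝒫≢ (inj₁ e) (inj₂ {d = C′} f) →
                        vertex∈class (∈ᶜ-owner C C′ v∈C 𝒫≢ e f)
                    ; (class∋vertex {C = C} v∈C) 𝒫≢ (inj₂ {d = C′} f) (inj₁ e) →
                        class∋vertex (∈ᶜ-owner C C′ v∈C (𝒫≢ ∘ sym) e f) }
    ; transfer  = λ { (vertex∈class {C = C} v∈C) (inj₁ {c = v′} e) →
                        inj₂ [ v′ ]≈ , inj₂ (⟶⇒⟶′ C v∈C e) , vertex∈class (∈-class⁺ ≈-refl)
                    ; (class∋vertex {v} v∈C) (inj₂ f) →
                        -- A quotient edge is a function giving each member of `C` a matching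
                        -- successor, so applying it to `v` answers the move.
                        let v′ , e , v′∈C′ = f v v∈C
                        in  inj₁ v′ , inj₁ e , class∋vertex v′∈C′ }
    }

theorem14 : (𝒢 : ParityGame) → 𝒢 ≈ᴳ quotient 𝒢
theorem14 𝒢 =
    (λ v → [ v ]≈ , bisimilar (∈-class⁺ ≈-refl))
  , (λ C → proj₁ (representative C) , bisimilar (representative-∈ᶜ C))
  where
  open Governed 𝒢 using (_∈ᶜ_; [_]≈; ∈-class⁺; ≈-refl; representative)
  open GovernedProperties 𝒢

  bisimilar : ∀ {v C} → v ∈ᶜ C → Governed._≈_ (𝒢 ⊎ᴳ quotient 𝒢) (inj₁ v) (inj₂ C)
  bisimilar v∈C = Membership , membership-isGovernedBisimulation , vertex∈class v∈C
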